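{- If the field $\langle L,+,\times\rangle$ is an extension of finite degree of the field $\langle\mathbb{Q},+,\times\rangle$, then computability is stable over $\langle L,+,\times\rangle$.
   Context: Computability over natural numbers is the usual one. A set $A \subseteq \mathbb{N}$ is effectively enumerable if it is empty or the image of a total computable function from $\mathbb{N}$ to $\mathbb{N}$. For $A \subseteq \mathbb{N}^m$ and $B \subseteq \mathbb{N}$, a computable function from $A$ to $B$ is a partial computable function that is defined at every element of $A$ and takes values in $B$ there. Indexing: an indexing of a set $E$ is a partial function $i$ from $\mathbb{N}$ to $E$ such that $dom(i)$ is effectively enumerable, $i$ is surjective, and there is a computable function $eq$ from $dom(i)\times dom(i)$ to $\{0,1\}$ with $eq(x,y)=1$ if $i(x)=i(y)$ and $eq(x,y)=0$ otherwise. An indexing $i$ of the set $E$ is an admissible indexing of a one-sorted structure $\langle E,op_1,\ldots,op_p\rangle$ if every operation $op: E^m\to E$ among $op_1,\ldots,op_p$ is computable relatively to $i$, that is, there is a computable function $\hat{op}$ from $dom(i)^m$ to $dom(i)$ such that $i(\hat{op}(x_1,\ldots,x_m)) = op(i(x_1),\ldots,i(x_m))$ for all $x_1,\ldots,x_m\in dom(i)$. Computability is stable over $\langle E,op_1,\ldots,op_p\rangle$ if there exists an admissible indexing of this structure and, for all admissible indexings $j$ and $j'$ of it, there exists a computable function $h$ from $dom(j')$ to $dom(j)$ such that $j' = j\circ h$. -}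

module Defs where


open import Level using (Level; _⊔_; 0ℓ; suc)
open import Algebra.Apartness.Bundles using (HeytingField; HeytingCommutativeRing)
open import Algebra.Bundles using (CommutativeRing)
open import Algebra.Morphism.Structures using (IsRingMonomorphism)
import Algebra.Properties.CommutativeMonoid.Sum as Sum
open import Data.Fin.Base using (Fin)
open import Data.List.Base as List using (List)
import Data.List.Relation.Unary.All as ListAll
open import Data.Nat.Base as ℕ using (ℕ; zero; _<_)
open import Data.Product.Base using (Σ-syntax; ∃-syntax; _×_; _,_; proj₁; proj₂)
open import Data.Sum.Base using (_⊎_)
open import Data.Vec.Base using (Vec; []; _∷_; lookup)
open import Data.Vec.Functional using (Vector)
open import Data.Vec.Relation.Binary.Pointwise.Inductive using (Pointwise; []; _∷_)
open import Data.Vec.Relation.Unary.All using (All; []; _∷_; reduce)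
open import Relation.Binary.Bundles using (Setoid)
open import Relation.Binary.PropositionalEquality.Core using (_≡_)
open import Relation.Nullary.Negation.Core using (¬_)
open import Relation.Unary using (Pred; U; Empty; _≐_)

------------------------------------------------------------------------
-- Partial computable functions

-- Programs for the partial (μ-)recursive functions ℕᵐ ⇀ ℕ.
data Rec : ℕ → Set where
  zeroᶠ : Rec 0
  sucᶠ  : Rec 1
  proj  : ∀ {m} → Fin m → Rec m
  comp  : ∀ {m n} → Rec n → Vec (Rec m) n → Rec m
  prec  : ∀ {m} → Rec m → Rec (2 ℕ.+ m) → Rec (1 ℕ.+ m)
  μ     : ∀ {m} → Rec (1 ℕ.+ m) → Rec m

infix 4 _[_]⇓_

-- f [ xs ]⇓ y : the function computed by f is defined at xs, with value y.
data _[_]⇓_ : ∀ {m} → Rec m → Vec ℕ m → ℕ → Set where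
  zero⇓ : zeroᶠ [ [] ]⇓ 0
  suc⇓  : ∀ {x} → sucᶠ [ x ∷ [] ]⇓ ℕ.suc x
  proj⇓ : ∀ {m} {xs : Vec ℕ m} k → proj k [ xs ]⇓ lookup xs k
  comp⇓ : ∀ {m n} {f : Rec n} {gs : Vec (Rec m) n} {xs ys z} →
          Pointwise (λ g y → g [ xs ]⇓ y) gs ys → f [ ys ]⇓ z →
          comp f gs [ xs ]⇓ z
  prec⇓-zero : ∀ {m} {f : Rec m} {g xs y} →
               f [ xs ]⇓ y → prec f g [ zero ∷ xs ]⇓ y
  prec⇓-suc  : ∀ {m} {f : Rec m} {g n xs y z} →
               prec f g [ n ∷ xs ]⇓ y → g [ n ∷ y ∷ xs ]⇓ z →
               prec f g [ ℕ.suc n ∷ xs ]⇓ z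
  μ⇓    : ∀ {m} {f : Rec (1 ℕ.+ m)} {xs n} →
          (∀ i → i < n → ∃[ k ] f [ i ∷ xs ]⇓ ℕ.suc k) → f [ n ∷ xs ]⇓ 0 →
          μ f [ xs ]⇓ n

-- A computable function from A ⊆ ℕᵐ to B ⊆ ℕ: the program may also be
-- defined outside A.
record ComputableFunction {m} (A : Pred (Vec ℕ m) 0ℓ) (B : Pred ℕ 0ℓ) : Set where
  field
    program : Rec m
    defined : ∀ {xs} → A xs → ∃[ y ] program [ xs ]⇓ y × B y

  value : ∀ {xs} → A xs → ℕ
  value xs∈A = proj₁ (defined xs∈A)

  value∈ : ∀ {xs} (xs∈A : A xs) → B (value xs∈A)
  value∈ xs∈A = proj₂ (proj₂ (defined xs∈A))

open ComputableFunction public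

Image : ComputableFunction {1} U U → Pred ℕ 0ℓ
Image f y = ∃[ n ] value f {n ∷ []} _ ≡ y

EffectivelyEnumerable : Pred ℕ 0ℓ → Set
EffectivelyEnumerable A = Empty A ⊎ ∃[ f ] A ≐ Image f

private variable
  a ℓ : Level

------------------------------------------------------------------------
-- Indexings

record Indexing (E : Setoid a ℓ) : Set (suc 0ℓ ⊔ a ⊔ ℓ) where
  open Setoid E
  field
    dom   : Pred ℕ 0ℓ
    index : ∀ {x} → dom x → Carrier
    -- the value depends on x only, not on the proof that x lies in dom
    index-irrelevant : ∀ {x} (p q : dom x) → index p ≈ index q
    dom-enumerable   : EffectivelyEnumerable dom
    surjective       : ∀ e → ∃[ x ] Σ[ p ∈ dom x ] index {x} p ≈ e
    eq   : ComputableFunction {2} (All dom) (λ b → b ≡ 0 ⊎ b ≡ 1)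
    eq-1 : ∀ {x y} (p : dom x) (q : dom y) →
           index p ≈ index q → value eq (p ∷ q ∷ []) ≡ 1
    eq-0 : ∀ {x y} (p : dom x) (q : dom y) →
           ¬ index p ≈ index q → value eq (p ∷ q ∷ []) ≡ 0

open Indexing public

------------------------------------------------------------------------
-- One-sorted structures

record Operation (E : Setoid a ℓ) : Set (a ⊔ ℓ) where
  open Setoid E
  field
    arity   : ℕ
    apply   : Vec Carrier arity → Carrier
    cong    : ∀ {xs ys} → Pointwise _≈_ xs ys → apply xs ≈ apply ys

open Operation public

record Structure a ℓ : Set (suc (a ⊔ ℓ)) where
  field
    domain     : Setoid a ℓ
    operations : List (Operation domain)

open Structure public

ComputableRelativelyTo : {E : Setoid a ℓ} → Indexing E → Operation E → Set ℓ
ComputableRelativelyTo {E = E} i op =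
  Σ[ op^ ∈ ComputableFunction {arity op} (All (dom i)) (dom i) ]
    (∀ {xs} (ps : All (dom i) xs) →
       index i (value∈ op^ ps) ≈ apply op (reduce (index i) ps))
  where open Setoid E

Admissible : (S : Structure a ℓ) → Indexing (domain S) → Set (a ⊔ ℓ)
Admissible S i = ListAll.All (ComputableRelativelyTo i) (operations S)

-- h witnesses j′ = j ∘ h
Reduces : {E : Setoid a ℓ} → Indexing E → Indexing E → Set ℓ
Reduces {E = E} j′ j =
  Σ[ h ∈ ComputableFunction {1} (All (dom j′)) (dom j) ]
    (∀ {x} (p : dom j′ x) → index j′ p ≈ index j (value∈ h (p ∷ [])))
  where open Setoid E

ComputabilityStable : Structure a ℓ → Set (suc 0ℓ ⊔ a ⊔ ℓ)
ComputabilityStable S =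
  (∃[ i ] Admissible S i) ×
  (∀ j j′ → Admissible S j → Admissible S j′ → Reduces j′ j)

------------------------------------------------------------------------
-- Fields: the tight apartness of a Heyting field is, classically, just ≉.

module _ {c ℓ₁ ℓ₂} (F : HeytingField c ℓ₁ ℓ₂) where

  private
    commutativeRing : CommutativeRing c ℓ₁
    commutativeRing =
      HeytingCommutativeRing.commutativeRing (HeytingField.heytingCommutativeRing F)
  open CommutativeRing commutativeRing

  -- ⟨ F , + , × ⟩
  fieldStructure : Structure c ℓ₁
  fieldStructure = record
    { domain     = setoid
    ; operations = addition List.∷ multiplication List.∷ List.[]
    }
    where
    addition multiplication : Operation setoid
    addition = record
      { arity   = 2
      ; apply   = λ { (x ∷ y ∷ []) → x + y }
      ; cong    = λ { (p ∷ q ∷ []) → +-cong p q }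
      }
    multiplication = record
      { arity   = 2
      ; apply   = λ { (x ∷ y ∷ []) → x * y }
      ; cong    = λ { (p ∷ q ∷ []) → *-cong p q }
      }

module _ {c ℓ₁ ℓ₂ c′ ℓ₁′ ℓ₂′}
         (K : HeytingField c ℓ₁ ℓ₂) (L : HeytingField c′ ℓ₁′ ℓ₂′) where

  private
    ring : ∀ {a ℓ ℓ′} → HeytingField a ℓ ℓ′ → CommutativeRing a ℓ
    ring F =
      HeytingCommutativeRing.commutativeRing (HeytingField.heytingCommutativeRing F)
    module K = CommutativeRing (ring K)
    module L = CommutativeRing (ring L)
  open Sum L.+-commutativeMonoid using (sum)

  record Extension : Set (c ⊔ ℓ₁ ⊔ c′ ⊔ ℓ₁′) where
    field
      embed              : K.Carrier → L.Carrier
      isRingMonomorphism : IsRingMonomorphism K.rawRing L.rawRing embed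

    linearCombination : ∀ {n} → Vector K.Carrier n → Vector L.Carrier n → L.Carrier
    linearCombination a v = sum (λ k → embed (a k) L.* v k)

  -- L has a basis of n elements as a vector space over K.
  record HasDegree (ext : Extension) (n : ℕ) : Set (c ⊔ ℓ₁ ⊔ c′ ⊔ ℓ₁′) where
    open Extension ext
    field
      basis       : Vector L.Carrier n
      spanning    : ∀ x → ∃[ a ] x L.≈ linearCombination a basis
      independent : ∀ a → linearCombination a basis L.≈ L.0# →
                    ∀ k → a k K.≈ K.0#

  -- L is an extension of K of finite degree.
  FiniteExtension : Set (c ⊔ ℓ₁ ⊔ c′ ⊔ ℓ₁′)
  FiniteExtension = Σ[ ext ∈ Extension ] ∃[ n ] HasDegree ext n

{-# OPTIONS --safe #-}
module Submission where

-- Fix a basis b₁ , … , bₙ of L over ℚ. Coding an element by codes of its rational coordinates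
-- gives an admissible indexing ν : ℕ → L, since the structure constants of the basis are finitely
-- many rationals and ℚ is computable. Let j be any admissible indexing. The naturals of L are
-- computable in j by iterating + 1, and (p − q) / (1 + d) is the first y in an enumeration of
-- dom j with (1 + d) y + q = p; multiplying by codes of the bₖ and summing translates ν into j.
-- To go from j′ to j, search for a ν-code whose translation into j′ equals the given element,
-- and translate that code into j.

open import Defs
open import Algebra.Apartness.Bundles using (HeytingField; HeytingCommutativeRing)
open import Algebra.Bundles using (CommutativeRing)
open import Algebra.Morphism.Structures using (IsRingMonomorphism)
import Algebra.Properties.CommutativeMonoid.Sum as Sum
import Algebra.Properties.CommutativeSemigroup as CommutativeSemigroupProperties
import Algebra.Properties.Group as GroupProperties
import Algebra.Properties.Semiring.Sum as SemiringSum
open import Data.Fin.Base using (Fin; zero; suc)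
open import Data.Fin.Patterns using (0F; 1F; 2F)
open import Data.Fin.Properties using (all?)
import Data.Integer.Base as ℤ
import Data.Integer.Properties as ℤ
import Data.List.Relation.Unary.All as ListAll
open import Data.Nat.Base using (ℕ; zero; suc; pred; _+_; _*_; _∸_; _≤_; _<_; s≤s)
import Data.Nat.Properties as ℕ
open import Data.Product.Base using (Σ-syntax; ∃-syntax; _×_; _,_; proj₁; proj₂)
open import Data.Rational.Base as ℚ using (ℚ; mkℚ)
open import Data.Rational.Literals using (fromℤ)
import Data.Rational.Properties as ℚ
open import Data.Rational.Properties using () renaming (heytingField to ℚ-field)
open import Data.Rational.Solver using (module +-*-Solver)
import Data.Rational.Unnormalised.Base as ℚᵘ
import Data.Rational.Unnormalised.Properties as ℚᵘ
open import Data.Sum.Base using (_⊎_; inj₁; inj₂)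
open import Data.Vec.Base using (Vec; []; _∷_; lookup)
open import Data.Vec.Relation.Binary.Pointwise.Inductive using ([]; _∷_)
open import Data.Vec.Relation.Unary.All using (All; []; _∷_)
open import Function.Base using (_∘_)
open import Function.Bundles using (_⇔_; mk⇔; module Equivalence)
open import Level using (Level; _⊔_)
import Relation.Binary.Reasoning.Setoid as SetoidReasoning
open import Relation.Binary.Definitions using (tri<; tri≈; tri>)
open import Relation.Binary.PropositionalEquality as ≡
  using (_≡_; refl; sym; trans; subst; cong₂; module ≡-Reasoning)
open import Relation.Nullary using (¬_; Dec; yes; no; contradiction)
open import Relation.Nullary.Decidable using (map′)
open import Relation.Unary using (Pred; U; _≐_)

open Equivalence using (to; from)
open GroupProperties ℚ.+-0-group using () renaming (∙-cancelʳ to +-cancelʳ)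

private variable
  c ℓ ℓ₁ ℓ₂ : Level
  m n k : ℕ
  xs : Vec ℕ m
  x y z : ℕ

-- Programs

infix 4 _[_]∈_

_[_]∈_ : Rec m → Vec ℕ m → Pred ℕ ℓ → Set ℓ
f [ xs ]∈ B = ∃[ y ] f [ xs ]⇓ y × B y

∈-map : ∀ {f : Rec m} {P : Pred ℕ ℓ₁} {Q : Pred ℕ ℓ₂} → (∀ {y} → P y → Q y) →
        f [ xs ]∈ P → f [ xs ]∈ Q
∈-map P⇒Q (y , ⇓y , Py) = y , ⇓y , P⇒Q Py

comp₁ : Rec 1 → Rec m → Rec m
comp₁ h f = comp h (f ∷ [])

comp₂ : Rec 2 → Rec m → Rec m → Rec m
comp₂ h f g = comp h (f ∷ g ∷ [])

comp₁⇓ : ∀ {h} {f : Rec m} → f [ xs ]⇓ x → h [ x ∷ [] ]⇓ y → comp₁ h f [ xs ]⇓ y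
comp₁⇓ p = comp⇓ (p ∷ [])

comp₂⇓ : ∀ {h} {f g : Rec m} → f [ xs ]⇓ x → g [ xs ]⇓ y → h [ x ∷ y ∷ [] ]⇓ z →
         comp₂ h f g [ xs ]⇓ z
comp₂⇓ p q = comp⇓ (p ∷ q ∷ [])

const : ℕ → Rec m
const zero    = comp zeroᶠ []
const (suc a) = comp₁ sucᶠ (const a)

const⇓ : ∀ a → const a [ xs ]⇓ a
const⇓ zero    = comp⇓ [] zero⇓
const⇓ (suc a) = comp₁⇓ (const⇓ a) suc⇓

addition multiplication flippedMonus : Rec 2
addition       = prec (proj 0F) (comp₁ sucᶠ (proj 1F))
multiplication = prec (const 0) (comp₂ addition (proj 2F) (proj 1F))
flippedMonus   = prec (proj 0F) (comp₁ (prec (const 0) (proj 0F)) (proj 1F))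

addition⇓ : ∀ a b → addition [ a ∷ b ∷ [] ]⇓ a + b
addition⇓ zero    b = prec⇓-zero (proj⇓ 0F)
addition⇓ (suc a) b = prec⇓-suc (addition⇓ a b) (comp₁⇓ (proj⇓ 1F) suc⇓)

multiplication⇓ : ∀ a b → multiplication [ a ∷ b ∷ [] ]⇓ a * b
multiplication⇓ zero    b = prec⇓-zero (const⇓ 0)
multiplication⇓ (suc a) b =
  prec⇓-suc (multiplication⇓ a b) (comp₂⇓ (proj⇓ 2F) (proj⇓ 1F) (addition⇓ b (a * b)))

flippedMonus⇓ : ∀ b a → flippedMonus [ b ∷ a ∷ [] ]⇓ a ∸ b
flippedMonus⇓ zero    a = prec⇓-zero (proj⇓ 0F)
flippedMonus⇓ (suc b) a =
  subst (flippedMonus [ suc b ∷ a ∷ [] ]⇓_) (ℕ.pred[m∸n]≡m∸[1+n] a b)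
    (prec⇓-suc (flippedMonus⇓ b a) (comp₁⇓ (proj⇓ 1F) (pred⇓ (a ∸ b))))
  where
  pred⇓ : ∀ a → prec (const 0) (proj 0F) [ a ∷ [] ]⇓ pred a
  pred⇓ zero    = prec⇓-zero (const⇓ 0)
  pred⇓ (suc a) = prec⇓-suc (pred⇓ a) (proj⇓ 0F)

infixl 6 _⊕_ _⊖_
infixl 7 _⊗_

_⊕_ _⊗_ _⊖_ distance : Rec m → Rec m → Rec m
f ⊕ g = comp₂ addition f g
f ⊗ g = comp₂ multiplication f g
f ⊖ g = comp₂ flippedMonus g f
distance f g = (f ⊖ g) ⊕ (g ⊖ f)

module _ {f g : Rec m} (p : f [ xs ]⇓ x) (q : g [ xs ]⇓ y) where

  ⊕⇓ : f ⊕ g [ xs ]⇓ x + y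
  ⊕⇓ = comp₂⇓ p q (addition⇓ _ _)

  ⊗⇓ : f ⊗ g [ xs ]⇓ x * y
  ⊗⇓ = comp₂⇓ p q (multiplication⇓ _ _)

  ⊖⇓ : f ⊖ g [ xs ]⇓ x ∸ y
  ⊖⇓ = comp₂⇓ q p (flippedMonus⇓ _ _)

-- Unbounded search

Decides : Rec m → Vec ℕ m → Set ℓ → Set ℓ
Decides f xs A = f [ xs ]∈ λ v → v ≡ 0 ⇔ A

distance-decides : {f g : Rec m} → f [ xs ]⇓ x → g [ xs ]⇓ y →
                   Decides (distance f g) xs (x ≡ y)
distance-decides {x = x} {y} p q = _ , ⊕⇓ (⊖⇓ p q) (⊖⇓ q p) , mk⇔ distance≡0⇒≡ ≡⇒distance≡0
  where
  distance≡0⇒≡ : (x ∸ y) + (y ∸ x) ≡ 0 → x ≡ y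
  distance≡0⇒≡ eq = ℕ.≤-antisym
    (ℕ.m∸n≡0⇒m≤n (ℕ.m+n≡0⇒m≡0 (x ∸ y) eq)) (ℕ.m∸n≡0⇒m≤n (ℕ.m+n≡0⇒n≡0 (x ∸ y) eq))

  ≡⇒distance≡0 : x ≡ y → (x ∸ y) + (y ∸ x) ≡ 0
  ≡⇒distance≡0 refl = cong₂ _+_ (ℕ.n∸n≡0 x) (ℕ.n∸n≡0 x)

⋀ᶠ : ∀ {k} → (Fin k → Rec m) → Rec m
⋀ᶠ {k = zero}  fs = const 0
⋀ᶠ {k = suc k} fs = fs zero ⊕ ⋀ᶠ (fs ∘ suc)

⋀-decides : ∀ {k} {fs : Fin k → Rec m} {P : Fin k → Set ℓ} →
            (∀ t → Decides (fs t) xs (P t)) → Decides (⋀ᶠ fs) xs (∀ t → P t)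
⋀-decides {k = zero}  ds = 0 , const⇓ 0 , mk⇔ (λ _ ()) (λ _ → refl)
⋀-decides {k = suc k} ds with ds zero | ⋀-decides (ds ∘ suc)
... | u , ⇓u , iff₁ | v , ⇓v , iff₂ = u + v , ⊕⇓ ⇓u ⇓v , mk⇔
  (λ eq → λ { zero    → to iff₁ (ℕ.m+n≡0⇒m≡0 u eq)
            ; (suc t) → to iff₂ (ℕ.m+n≡0⇒n≡0 u eq) t })
  (λ all → cong₂ _+_ (from iff₁ (all zero)) (from iff₂ (all ∘ suc)))

module _ {f : Rec (suc m)} {xs} {P : Pred ℕ ℓ} (decides : ∀ i → Decides f (i ∷ xs) (P i)) where

  private
    Fails : Pred ℕ _
    Fails i = (∃[ k ] f [ i ∷ xs ]⇓ suc k) × ¬ P i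

    -- Invariant: the test fails everywhere below i, and fuel + i is a solution.
    searchFrom : ∀ {N} → P N → ∀ fuel i → fuel + i ≡ N → (∀ k → k < i → Fails k) →
                 ∃[ n ] μ f [ xs ]⇓ n × P n × (∀ k → k < n → ¬ P k)
    searchFrom PN fuel i eq below with decides i
    ... | zero , f⇓0 , iff =
      i , μ⇓ (λ k k<i → proj₁ (below k k<i)) f⇓0 , to iff refl , λ k k<i → proj₂ (below k k<i)
    searchFrom PN zero i refl below | suc _ , _ , iff = contradiction (sym (from iff PN)) ℕ.0≢1+n
    searchFrom PN (suc fuel) i eq below | suc v , f⇓ , iff =
      searchFrom PN fuel (suc i) (trans (ℕ.+-suc fuel i) eq) below′
      where
      below′ : ∀ k → k < suc i → Fails k
      below′ k (s≤s k≤i) with ℕ.m≤n⇒m<n∨m≡n k≤i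
      ... | inj₁ k<i  = below k k<i
      ... | inj₂ refl = (v , f⇓) , ℕ.1+n≢0 ∘ from iff

  leastSearch : ∃[ N ] P N → ∃[ n ] μ f [ xs ]⇓ n × P n × (∀ k → k < n → ¬ P k)
  leastSearch (N , PN) = searchFrom PN N 0 (ℕ.+-identityʳ N) λ _ ()

  search : ∃[ N ] P N → μ f [ xs ]∈ P
  search ∃P with n , μ⇓n , Pn , _ ← leastSearch ∃P = n , μ⇓n , Pn

-- Pairing: (a , b) ↦ (a + b)² + b has the left inverse n ↦ (s − (n − s²) , n − s²) with s the
-- integer square root of n, computed as the least s such that n < (s + 1)².

rootTest : Rec 2
rootTest = comp₁ sucᶠ (proj 1F) ⊖ comp₁ sucᶠ (proj 0F) ⊗ comp₁ sucᶠ (proj 0F)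

rootTest-decides : ∀ n s → Decides rootTest (s ∷ n ∷ []) (n < suc s * suc s)
rootTest-decides n s =
  _ , ⊖⇓ (comp₁⇓ (proj⇓ 1F) suc⇓) (⊗⇓ (comp₁⇓ (proj⇓ 0F) suc⇓) (comp₁⇓ (proj⇓ 0F) suc⇓)) ,
  mk⇔ ℕ.m∸n≡0⇒m≤n ℕ.m≤n⇒m∸n≡0

rootSearch : ∀ n → ∃[ s ] μ rootTest [ n ∷ [] ]⇓ s × n < suc s * suc s ×
                          (∀ i → i < s → ¬ n < suc i * suc i)
rootSearch n = leastSearch (rootTest-decides n) (n , ℕ.m≤m*n (suc n) (suc n))

opaque

  root : ℕ → ℕ
  root n = proj₁ (rootSearch n)

  root-unique : ∀ n s → s * s ≤ n → n < suc s * suc s → root n ≡ s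
  root-unique n s s²≤n n<[1+s]² with rootSearch n
  ... | r , _ , n<[1+r]² , least with ℕ.<-cmp r s
  ...   | tri< r<s _ _ = contradiction
            (ℕ.≤-trans n<[1+r]² (ℕ.≤-trans (ℕ.*-mono-≤ r<s r<s) s²≤n)) (ℕ.<-irrefl refl)
  ...   | tri≈ _ r≡s _ = r≡s
  ...   | tri> _ _ s<r = contradiction n<[1+s]² (least s s<r)

  pair : ℕ → ℕ → ℕ
  pair a b = (a + b) * (a + b) + b

  π₁ π₂ : ℕ → ℕ
  π₂ n = n ∸ root n * root n
  π₁ n = root n ∸ π₂ n

  root-pair : ∀ a b → root (pair a b) ≡ a + b
  root-pair a b = root-unique (pair a b) (a + b) (ℕ.m≤m+n _ b) (s≤s (begin
    s * s + b      ≤⟨ ℕ.+-monoʳ-≤ (s * s) (ℕ.m≤n+m b a) ⟩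
    s * s + s      ≡⟨ ℕ.+-comm (s * s) s ⟩
    s + s * s      ≤⟨ ℕ.+-monoʳ-≤ s (ℕ.*-monoʳ-≤ s (ℕ.n≤1+n s)) ⟩
    s + s * suc s  ∎))
    where
    open ℕ.≤-Reasoning
    s : ℕ
    s = a + b

  π₂-pair : ∀ a b → π₂ (pair a b) ≡ b
  π₂-pair a b rewrite root-pair a b = ℕ.m+n∸m≡n ((a + b) * (a + b)) b

  π₁-pair : ∀ a b → π₁ (pair a b) ≡ a
  π₁-pair a b rewrite π₂-pair a b | root-pair a b = ℕ.m+n∸n≡m a b

  pairᶠ : Rec m → Rec m → Rec m
  pairᶠ f g = (f ⊕ g) ⊗ (f ⊕ g) ⊕ g

  pair⇓ : {f g : Rec m} → f [ xs ]⇓ x → g [ xs ]⇓ y → pairᶠ f g [ xs ]⇓ pair x y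
  pair⇓ p q = ⊕⇓ (⊗⇓ (⊕⇓ p q) (⊕⇓ p q)) q

  rootᶠ π₁ᶠ π₂ᶠ : Rec m → Rec m
  rootᶠ = comp₁ (μ rootTest)
  π₂ᶠ f = f ⊖ rootᶠ f ⊗ rootᶠ f
  π₁ᶠ f = rootᶠ f ⊖ π₂ᶠ f

module _ {f : Rec m} (p : f [ xs ]⇓ x) where

  opaque
    unfolding π₁ᶠ

    root⇓ : rootᶠ f [ xs ]⇓ root x
    root⇓ = comp₁⇓ p (proj₁ (proj₂ (rootSearch x)))

    π₂⇓ : π₂ᶠ f [ xs ]⇓ π₂ x
    π₂⇓ = ⊖⇓ p (⊗⇓ root⇓ root⇓)

    π₁⇓ : π₁ᶠ f [ xs ]⇓ π₁ x
    π₁⇓ = ⊖⇓ root⇓ π₂⇓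

component : Fin k → ℕ → ℕ
component zero    n = π₁ n
component (suc t) n = component t (π₂ n)

encode : ∀ {k} → (Fin k → ℕ) → ℕ
encode {zero}  v = 0
encode {suc k} v = pair (v zero) (encode (v ∘ suc))

component-encode : ∀ {k} (v : Fin k → ℕ) t → component t (encode v) ≡ v t
component-encode v zero    = π₁-pair (v zero) _
component-encode v (suc t) =
  trans (≡.cong (component t) (π₂-pair (v zero) _)) (component-encode (v ∘ suc) t)

componentᶠ : Fin k → Rec m → Rec m
componentᶠ zero    f = π₁ᶠ f
componentᶠ (suc t) f = componentᶠ t (π₂ᶠ f)

component⇓ : ∀ (t : Fin k) {f : Rec m} → f [ xs ]⇓ x → componentᶠ t f [ xs ]⇓ component t x
component⇓ zero    p = π₁⇓ p
component⇓ (suc t) p = component⇓ t (π₂⇓ p)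

encodeᶠ : ∀ {k} → (Fin k → Rec m) → Rec m
encodeᶠ {k = zero}  fs = const 0
encodeᶠ {k = suc k} fs = pairᶠ (fs zero) (encodeᶠ (fs ∘ suc))

encode⇓ : ∀ {k} {fs : Fin k → Rec m} {v} → (∀ t → fs t [ xs ]⇓ v t) →
          encodeᶠ fs [ xs ]⇓ encode v
encode⇓ {k = zero}  p = const⇓ 0
encode⇓ {k = suc k} p = pair⇓ (p zero) (encode⇓ (p ∘ suc))

-- Rational numbers

-- Opaque, so that ring identities about ⟪ n ⟫ are not unfolded into integer arithmetic.
opaque

  ⟪_⟫ : ℕ → ℚ
  ⟪ n ⟫ = fromℤ (ℤ.+ n)

  ⟪⟫-injective : ⟪ x ⟫ ≡ ⟪ y ⟫ → x ≡ y
  ⟪⟫-injective eq = ℤ.+-injective (≡.cong ℚ.numerator eq)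

  ⟪⟫-homo-+ : ∀ a b → ⟪ a + b ⟫ ≡ ⟪ a ⟫ ℚ.+ ⟪ b ⟫
  ⟪⟫-homo-+ a b = ℚ.toℚᵘ-injective (ℚᵘ.≃-trans
    (ℚᵘ.*≡* (≡.cong (ℤ._* ℤ.1ℤ)
      (sym (cong₂ ℤ._+_ (ℤ.*-identityʳ (ℤ.+ a)) (ℤ.*-identityʳ (ℤ.+ b))))))
    (ℚᵘ.≃-sym (ℚ.toℚᵘ-homo-+ ⟪ a ⟫ ⟪ b ⟫)))

  ⟪⟫-homo-* : ∀ a b → ⟪ a * b ⟫ ≡ ⟪ a ⟫ ℚ.* ⟪ b ⟫
  ⟪⟫-homo-* a b = ℚ.toℚᵘ-injective (ℚᵘ.≃-trans
    (ℚᵘ.*≡* (≡.cong (ℤ._* ℤ.1ℤ) (ℤ.pos-* a b)))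
    (ℚᵘ.≃-sym (ℚ.toℚᵘ-homo-* ⟪ a ⟫ ⟪ b ⟫)))

  ⟪0⟫ : ⟪ 0 ⟫ ≡ ℚ.0ℚ
  ⟪0⟫ = refl

  ⟪1⟫ : ⟪ 1 ⟫ ≡ ℚ.1ℚ
  ⟪1⟫ = refl

  reciprocal : ℕ → ℚ
  reciprocal d = ℚ.1/ ⟪ suc d ⟫

  reciprocal-inverse : ∀ d → reciprocal d ℚ.* ⟪ suc d ⟫ ≡ ℚ.1ℚ
  reciprocal-inverse d = ℚ.*-inverseˡ ⟪ suc d ⟫

  ⟪denominator⟫-* : ∀ r → ⟪ ℚ.↧ₙ r ⟫ ℚ.* r ≡ fromℤ (ℚ.↥ r)
  ⟪denominator⟫-* r@(mkℚ z d _) = ℚ.toℚᵘ-injective (ℚᵘ.≃-trans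
    (ℚ.toℚᵘ-homo-* ⟪ suc d ⟫ r)
    (ℚᵘ.*≡* (trans (ℤ.*-identityʳ _) (trans (ℤ.*-comm (ℤ.+ suc d) z)
      (≡.cong (λ k → z ℤ.* ℤ.+ k) (sym (ℕ.*-identityˡ (suc d))))))))

  isFraction-exists : ∀ r → ∃[ p ] ∃[ q ] ∃[ d ] ⟪ suc d ⟫ ℚ.* r ℚ.+ ⟪ q ⟫ ≡ ⟪ p ⟫
  isFraction-exists r@(mkℚ (ℤ.+ n) d _) =
    n , 0 , d , trans (ℚ.+-identityʳ _) (⟪denominator⟫-* r)
  isFraction-exists r@(mkℚ ℤ.-[1+ n ] d _) =
    0 , suc n , d , trans (≡.cong (ℚ._+ ⟪ suc n ⟫) (⟪denominator⟫-* r))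
                          (ℚ.+-inverseˡ ⟪ suc n ⟫)

-- r = (p − q) / (1 + d), with both sides moved so that only + and × occur.
IsFraction : (p q d : ℕ) → ℚ → Set
IsFraction p q d r = ⟪ suc d ⟫ ℚ.* r ℚ.+ ⟪ q ⟫ ≡ ⟪ p ⟫

fraction : ℕ → ℕ → ℕ → ℚ
fraction p q d = reciprocal d ℚ.* (⟪ p ⟫ ℚ.- ⟪ q ⟫)

fraction-isFraction : ∀ p q d → IsFraction p q d (fraction p q d)
fraction-isFraction p q d = begin
  ⟪ suc d ⟫ ℚ.* (reciprocal d ℚ.* (⟪ p ⟫ ℚ.- ⟪ q ⟫)) ℚ.+ ⟪ q ⟫
    ≡⟨ solve 4 (λ D I P Q → D :* (I :* (P :- Q)) :+ Q := (I :* D) :* (P :- Q) :+ Q) refl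
         ⟪ suc d ⟫ (reciprocal d) ⟪ p ⟫ ⟪ q ⟫ ⟩
  (reciprocal d ℚ.* ⟪ suc d ⟫) ℚ.* (⟪ p ⟫ ℚ.- ⟪ q ⟫) ℚ.+ ⟪ q ⟫
    ≡⟨ ≡.cong (λ u → u ℚ.* (⟪ p ⟫ ℚ.- ⟪ q ⟫) ℚ.+ ⟪ q ⟫) (reciprocal-inverse d) ⟩
  ℚ.1ℚ ℚ.* (⟪ p ⟫ ℚ.- ⟪ q ⟫) ℚ.+ ⟪ q ⟫
    ≡⟨ solve 2 (λ P Q → con ℚ.1ℚ :* (P :- Q) :+ Q := P) refl ⟪ p ⟫ ⟪ q ⟫ ⟩
  ⟪ p ⟫ ∎
  where
  open ≡-Reasoning
  open +-*-Solver

denominator-cancel : ∀ d {r s} → ⟪ suc d ⟫ ℚ.* r ≡ ⟪ suc d ⟫ ℚ.* s → r ≡ s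
denominator-cancel d {r} {s} eq =
  trans (sym (undo r)) (trans (≡.cong (reciprocal d ℚ.*_) eq) (undo s))
  where
  undo : ∀ r → reciprocal d ℚ.* (⟪ suc d ⟫ ℚ.* r) ≡ r
  undo r = begin
    reciprocal d ℚ.* (⟪ suc d ⟫ ℚ.* r)  ≡⟨ ℚ.*-assoc (reciprocal d) ⟪ suc d ⟫ r ⟨
    reciprocal d ℚ.* ⟪ suc d ⟫ ℚ.* r    ≡⟨ ≡.cong (ℚ._* r) (reciprocal-inverse d) ⟩
    ℚ.1ℚ ℚ.* r                          ≡⟨ ℚ.*-identityˡ r ⟩
    r                                   ∎
    where open ≡-Reasoning

IsFraction-unique : ∀ {p q d r s} → IsFraction p q d r → IsFraction p q d s → r ≡ s
IsFraction-unique {q = q} {d} {r} {s} isR isS =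
  denominator-cancel d (+-cancelʳ ⟪ q ⟫ _ _ (trans isR (sym isS)))

IsFraction-+ : ∀ {p q d p′ q′ d′ r r′} → IsFraction p q d r → IsFraction p′ q′ d′ r′ →
               IsFraction (p * suc d′ + p′ * suc d) (q * suc d′ + q′ * suc d)
                          (d′ + d * suc d′) (r ℚ.+ r′)
IsFraction-+ {p} {q} {d} {p′} {q′} {d′} {r} {r′} isR isR′
  rewrite ⟪⟫-homo-* (suc d) (suc d′)
        | ⟪⟫-homo-+ (p * suc d′) (p′ * suc d) | ⟪⟫-homo-* p (suc d′) | ⟪⟫-homo-* p′ (suc d)
        | ⟪⟫-homo-+ (q * suc d′) (q′ * suc d) | ⟪⟫-homo-* q (suc d′) | ⟪⟫-homo-* q′ (suc d)
        | sym isR | sym isR′ =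
  solve 6 (λ D D′ Q Q′ R R′ →
      D :* D′ :* (R :+ R′) :+ (Q :* D′ :+ Q′ :* D) :=
      (D :* R :+ Q) :* D′ :+ (D′ :* R′ :+ Q′) :* D)
    refl ⟪ suc d ⟫ ⟪ suc d′ ⟫ ⟪ q ⟫ ⟪ q′ ⟫ r r′
  where open +-*-Solver

IsFraction-* : ∀ {p q d p′ q′ d′ r r′} → IsFraction p q d r → IsFraction p′ q′ d′ r′ →
               IsFraction (p * p′ + q * q′) (p * q′ + q * p′)
                          (d′ + d * suc d′) (r ℚ.* r′)
IsFraction-* {p} {q} {d} {p′} {q′} {d′} {r} {r′} isR isR′
  rewrite ⟪⟫-homo-* (suc d) (suc d′)
        | ⟪⟫-homo-+ (p * p′) (q * q′) | ⟪⟫-homo-* p p′ | ⟪⟫-homo-* q q′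
        | ⟪⟫-homo-+ (p * q′) (q * p′) | ⟪⟫-homo-* p q′ | ⟪⟫-homo-* q p′
        | sym isR | sym isR′ =
  solve 6 (λ D D′ Q Q′ R R′ →
      D :* D′ :* (R :* R′) :+ ((D :* R :+ Q) :* Q′ :+ Q :* (D′ :* R′ :+ Q′)) :=
      (D :* R :+ Q) :* (D′ :* R′ :+ Q′) :+ Q :* Q′)
    refl ⟪ suc d ⟫ ⟪ suc d′ ⟫ ⟪ q ⟫ ⟪ q′ ⟫ r r′
  where open +-*-Solver

module _ {p q d p′ q′ d′ r r′} (isR : IsFraction p q d r) (isR′ : IsFraction p′ q′ d′ r′) where

  private
    open +-*-Solver

    lhs : ⟪ p * suc d′ + q′ * suc d ⟫ ≡
          ⟪ suc d ⟫ ℚ.* (⟪ suc d′ ⟫ ℚ.* r) ℚ.+ (⟪ q ⟫ ℚ.* ⟪ suc d′ ⟫ ℚ.+ ⟪ q′ ⟫ ℚ.* ⟪ suc d ⟫)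
    lhs rewrite ⟪⟫-homo-+ (p * suc d′) (q′ * suc d) | ⟪⟫-homo-* p (suc d′) | ⟪⟫-homo-* q′ (suc d)
              | sym isR =
      solve 5 (λ D D′ Q Q′ R →
          (D :* R :+ Q) :* D′ :+ Q′ :* D := D :* (D′ :* R) :+ (Q :* D′ :+ Q′ :* D))
        refl ⟪ suc d ⟫ ⟪ suc d′ ⟫ ⟪ q ⟫ ⟪ q′ ⟫ r

    rhs : ⟪ p′ * suc d + q * suc d′ ⟫ ≡
          ⟪ suc d ⟫ ℚ.* (⟪ suc d′ ⟫ ℚ.* r′) ℚ.+ (⟪ q ⟫ ℚ.* ⟪ suc d′ ⟫ ℚ.+ ⟪ q′ ⟫ ℚ.* ⟪ suc d ⟫)
    rhs rewrite ⟪⟫-homo-+ (p′ * suc d) (q * suc d′) | ⟪⟫-homo-* p′ (suc d) | ⟪⟫-homo-* q (suc d′)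
              | sym isR′ =
      solve 5 (λ D D′ Q Q′ R →
          (D′ :* R :+ Q′) :* D :+ Q :* D′ := D :* (D′ :* R) :+ (Q :* D′ :+ Q′ :* D))
        refl ⟪ suc d ⟫ ⟪ suc d′ ⟫ ⟪ q ⟫ ⟪ q′ ⟫ r′

  IsFraction-≡⁺ : r ≡ r′ → p * suc d′ + q′ * suc d ≡ p′ * suc d + q * suc d′
  IsFraction-≡⁺ refl = ⟪⟫-injective (trans lhs (sym rhs))

  IsFraction-≡⁻ : p * suc d′ + q′ * suc d ≡ p′ * suc d + q * suc d′ → r ≡ r′
  IsFraction-≡⁻ eq = denominator-cancel d′ (denominator-cancel d
    (+-cancelʳ _ _ _ (trans (sym lhs) (trans (≡.cong ⟪_⟫ eq) rhs))))

-- Codes of rational numbers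

num⁺ num⁻ den : ℕ → ℕ
num⁺ = component {3} 0F
num⁻ = component {3} 1F
den  = component {3} 2F

rational : ℕ → ℚ
rational n = fraction (num⁺ n) (num⁻ n) (den n)

rational-isFraction : ∀ n → IsFraction (num⁺ n) (num⁻ n) (den n) (rational n)
rational-isFraction n = fraction-isFraction (num⁺ n) (num⁻ n) (den n)

fractionCode : ℕ → ℕ → ℕ → ℕ
fractionCode p q d = encode (lookup (p ∷ q ∷ d ∷ []))

rational-fractionCode : ∀ {p q d r} → IsFraction p q d r → rational (fractionCode p q d) ≡ r
rational-fractionCode {p} {q} {d} isR
  rewrite component-encode (lookup (p ∷ q ∷ d ∷ [])) 0F
        | component-encode (lookup (p ∷ q ∷ d ∷ [])) 1F
        | component-encode (lookup (p ∷ q ∷ d ∷ [])) 2F =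
  IsFraction-unique (fraction-isFraction p q d) isR

rational-surjective : ∀ r → ∃[ n ] rational n ≡ r
rational-surjective r with p , q , d , isR ← isFraction-exists r =
  fractionCode p q d , rational-fractionCode isR

num⁺ᶠ num⁻ᶠ denomᶠ : Rec m → Rec m
num⁺ᶠ    = componentᶠ {3} 0F
num⁻ᶠ    = componentᶠ {3} 1F
denomᶠ f = comp₁ sucᶠ (componentᶠ {3} 2F f)

module _ {f : Rec m} (p : f [ xs ]⇓ x) where

  num⁺⇓ : num⁺ᶠ f [ xs ]⇓ num⁺ x
  num⁺⇓ = component⇓ {k = 3} 0F p

  num⁻⇓ : num⁻ᶠ f [ xs ]⇓ num⁻ x
  num⁻⇓ = component⇓ {k = 3} 1F p

  denom⇓ : denomᶠ f [ xs ]⇓ suc (den x)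
  denom⇓ = comp₁⇓ (component⇓ {k = 3} 2F p) suc⇓

-- The third program computes the denominator 1 + d.
fractionCodeᶠ : Rec m → Rec m → Rec m → Rec m
fractionCodeᶠ f g h = encodeᶠ (lookup (f ∷ g ∷ h ⊖ const 1 ∷ []))

fractionCode⇓ : ∀ {f g h : Rec m} {p q d} → f [ xs ]⇓ p → g [ xs ]⇓ q → h [ xs ]⇓ suc d →
                fractionCodeᶠ f g h [ xs ]⇓ fractionCode p q d
fractionCode⇓ {f = f} {g} {h} {p} {q} {d} pf pg ph = encode⇓
  {fs = lookup (f ∷ g ∷ h ⊖ const 1 ∷ [])} {v = lookup (p ∷ q ∷ d ∷ [])}
  λ { 0F → pf ; 1F → pg ; 2F → ⊖⇓ ph (const⇓ 1) }

module _ (f g : Rec m) where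

  rational-+ᶠ rational-*ᶠ rational-≡ᶠ : Rec m
  rational-+ᶠ = fractionCodeᶠ
    (num⁺ᶠ f ⊗ denomᶠ g ⊕ num⁺ᶠ g ⊗ denomᶠ f)
    (num⁻ᶠ f ⊗ denomᶠ g ⊕ num⁻ᶠ g ⊗ denomᶠ f)
    (denomᶠ f ⊗ denomᶠ g)
  rational-*ᶠ = fractionCodeᶠ
    (num⁺ᶠ f ⊗ num⁺ᶠ g ⊕ num⁻ᶠ f ⊗ num⁻ᶠ g)
    (num⁺ᶠ f ⊗ num⁻ᶠ g ⊕ num⁻ᶠ f ⊗ num⁺ᶠ g)
    (denomᶠ f ⊗ denomᶠ g)
  rational-≡ᶠ = distance
    (num⁺ᶠ f ⊗ denomᶠ g ⊕ num⁻ᶠ g ⊗ denomᶠ f)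
    (num⁺ᶠ g ⊗ denomᶠ f ⊕ num⁻ᶠ f ⊗ denomᶠ g)

module _ {f g : Rec m} (p : f [ xs ]⇓ x) (q : g [ xs ]⇓ y) where

  rational-+∈ : rational-+ᶠ f g [ xs ]∈ λ z → rational z ≡ rational x ℚ.+ rational y
  rational-+∈ =
    _ ,
    fractionCode⇓ (⊕⇓ (⊗⇓ (num⁺⇓ p) (denom⇓ q)) (⊗⇓ (num⁺⇓ q) (denom⇓ p)))
                  (⊕⇓ (⊗⇓ (num⁻⇓ p) (denom⇓ q)) (⊗⇓ (num⁻⇓ q) (denom⇓ p)))
                  (⊗⇓ (denom⇓ p) (denom⇓ q)) ,
    rational-fractionCode (IsFraction-+ (rational-isFraction x) (rational-isFraction y))

  rational-*∈ : rational-*ᶠ f g [ xs ]∈ λ z → rational z ≡ rational x ℚ.* rational y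
  rational-*∈ =
    _ ,
    fractionCode⇓ (⊕⇓ (⊗⇓ (num⁺⇓ p) (num⁺⇓ q)) (⊗⇓ (num⁻⇓ p) (num⁻⇓ q)))
                  (⊕⇓ (⊗⇓ (num⁺⇓ p) (num⁻⇓ q)) (⊗⇓ (num⁻⇓ p) (num⁺⇓ q)))
                  (⊗⇓ (denom⇓ p) (denom⇓ q)) ,
    rational-fractionCode (IsFraction-* (rational-isFraction x) (rational-isFraction y))

  rational-≡-decides : Decides (rational-≡ᶠ f g) xs (rational x ≡ rational y)
  rational-≡-decides =
    ∈-map (λ iff → mk⇔ (IsFraction-≡⁻ isX isY ∘ to iff) (from iff ∘ IsFraction-≡⁺ isX isY))
      (distance-decides (⊕⇓ (⊗⇓ (num⁺⇓ p) (denom⇓ q)) (⊗⇓ (num⁻⇓ q) (denom⇓ p)))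
                        (⊕⇓ (⊗⇓ (num⁺⇓ q) (denom⇓ p)) (⊗⇓ (num⁻⇓ p) (denom⇓ q))))
    where
    isX = rational-isFraction x
    isY = rational-isFraction y

-- Realizability of ring operations on codes

ring : HeytingField c ℓ₁ ℓ₂ → CommutativeRing c ℓ₁
ring F = HeytingCommutativeRing.commutativeRing (HeytingField.heytingCommutativeRing F)

record Realizability (R : CommutativeRing c ℓ) : Set (c ⊔ Level.suc ℓ) where
  private module R = CommutativeRing R
  open Sum R.+-commutativeMonoid using (sum)

  infix 4 _⊩_
  field
    _⊩_      : ℕ → R.Carrier → Set ℓ
    realized : ∀ e → ∃[ a ] a ⊩ e
    +ᶠ *ᶠ    : Rec m → Rec m → Rec m
    +∈ : ∀ {f g : Rec m} {d e} → f [ xs ]∈ (_⊩ d) → g [ xs ]∈ (_⊩ e) →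
         +ᶠ f g [ xs ]∈ (_⊩ (d R.+ e))
    *∈ : ∀ {f g : Rec m} {d e} → f [ xs ]∈ (_⊩ d) → g [ xs ]∈ (_⊩ e) →
         *ᶠ f g [ xs ]∈ (_⊩ (d R.* e))

  constant : R.Carrier → Rec m
  constant e = const (proj₁ (realized e))

  constant∈ : ∀ e → constant e [ xs ]∈ (_⊩ e)
  constant∈ e = _ , const⇓ _ , proj₂ (realized e)

  ∑ᶠ : ∀ {k} → (Fin k → Rec m) → Rec m
  ∑ᶠ {k = zero}  fs = constant R.0#
  ∑ᶠ {k = suc k} fs = +ᶠ (fs zero) (∑ᶠ (fs ∘ suc))

  ∑∈ : ∀ {k} {fs : Fin k → Rec m} {v} → (∀ t → fs t [ xs ]∈ (_⊩ v t)) →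
       ∑ᶠ fs [ xs ]∈ (_⊩ sum v)
  ∑∈ {k = zero}  ps = constant∈ R.0#
  ∑∈ {k = suc k} ps = +∈ (ps zero) (∑∈ (ps ∘ suc))

rationalRealizability : Realizability (ring ℚ-field)
rationalRealizability = record
  { _⊩_      = λ n r → rational n ≡ r
  ; realized = rational-surjective
  ; +ᶠ       = rational-+ᶠ
  ; *ᶠ       = rational-*ᶠ
  ; +∈       = λ { (_ , p , refl) (_ , q , refl) → rational-+∈ p q }
  ; *∈       = λ { (_ , p , refl) (_ , q , refl) → rational-*∈ p q }
  }

module _ (L : HeytingField c ℓ₁ ℓ₂) where

  private module L = CommutativeRing (ring L)

  module AdmissibleIndexing (i : Indexing (domain (fieldStructure L)))
                            (admissible : Admissible (fieldStructure L) i) where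

    infix 4 _⊩_
    _⊩_ : ℕ → L.Carrier → Set _
    a ⊩ e = Σ[ p ∈ dom i a ] index i p L.≈ e

    ⊩-resp : ∀ {a d e} → d L.≈ e → a ⊩ d → a ⊩ e
    ⊩-resp d≈e (p , eq) = p , L.trans eq d≈e

    ∈-resp : ∀ {f : Rec m} {d e} → d L.≈ e → f [ xs ]∈ (_⊩ d) → f [ xs ]∈ (_⊩ e)
    ∈-resp d≈e = ∈-map (⊩-resp d≈e)

    realizability : Realizability (ring L)
    realizability = record
      { _⊩_      = _⊩_
      ; realized = surjective i
      ; +ᶠ       = comp₂ (program sum^)
      ; *ᶠ       = comp₂ (program product^)
      ; +∈       = λ { (_ , ⇓a , p , eqp) (_ , ⇓b , q , eqq) →
                       let ps = p ∷ q ∷ [] in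
                       value sum^ ps , comp₂⇓ ⇓a ⇓b (proj₁ (proj₂ (defined sum^ ps))) ,
                       value∈ sum^ ps , L.trans (sum-ok ps) (L.+-cong eqp eqq) }
      ; *∈       = λ { (_ , ⇓a , p , eqp) (_ , ⇓b , q , eqq) →
                       let ps = p ∷ q ∷ [] in
                       value product^ ps , comp₂⇓ ⇓a ⇓b (proj₁ (proj₂ (defined product^ ps))) ,
                       value∈ product^ ps , L.trans (product-ok ps) (L.*-cong eqp eqq) }
      }
      where
      sum^       = proj₁ (ListAll.head admissible)
      sum-ok     = λ {xs} → proj₂ (ListAll.head admissible) {xs}
      product^   = proj₁ (ListAll.head (ListAll.tail admissible))
      product-ok = λ {xs} → proj₂ (ListAll.head (ListAll.tail admissible)) {xs}

    open Realizability realizability public hiding (_⊩_)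

    equalᶠ : Rec m → Rec m → Rec m
    equalᶠ f g = const 1 ⊖ comp₂ (program (eq i)) f g

    equal-decides : ∀ {f g : Rec m} {d e} → Dec (d L.≈ e) →
                    f [ xs ]∈ (_⊩ d) → g [ xs ]∈ (_⊩ e) → Decides (equalᶠ f g) xs (d L.≈ e)
    equal-decides {d = d} {e} d≟e (_ , ⇓a , p , eqp) (_ , ⇓b , q , eqq) =
      _ , ⊖⇓ (const⇓ 1) (comp₂⇓ ⇓a ⇓b (proj₁ (proj₂ (defined (eq i) (p ∷ q ∷ []))))) ,
      decide d≟e
      where
      decide : Dec (d L.≈ e) → 1 ∸ value (eq i) (p ∷ q ∷ []) ≡ 0 ⇔ d L.≈ e
      decide (yes d≈e) = mk⇔ (λ _ → d≈e)
        λ _ → ≡.cong (1 ∸_) (eq-1 i p q (L.trans eqp (L.trans d≈e (L.sym eqq))))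
      decide (no d≉e) = mk⇔
        (λ v≡0 → contradiction (trans (sym (≡.cong (1 ∸_) v≡0′)) v≡0) ℕ.1+n≢0)
        (λ d≈e → contradiction d≈e d≉e)
        where
        v≡0′ = eq-0 i p q (λ p≈q → d≉e (L.trans (L.sym eqp) (L.trans p≈q eqq)))

    enumerator : ∃[ e ] dom i ≐ Image e
    enumerator with dom-enumerable i
    ... | inj₁ empty = contradiction (proj₁ (proj₂ (surjective i L.0#))) (empty _)
    ... | inj₂ e     = e

    element : ℕ → L.Carrier
    element n = index i (proj₂ (proj₂ enumerator) (n , refl))

    elementᶠ : Rec m → Rec m
    elementᶠ = comp₁ (program (proj₁ enumerator))

    element∈ : ∀ {f : Rec m} → f [ xs ]⇓ n → elementᶠ f [ xs ]∈ (_⊩ element n)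
    element∈ p = _ , comp₁⇓ p (proj₁ (proj₂ (defined (proj₁ enumerator) _))) , _ , L.refl

    element-surjective : ∀ e → ∃[ n ] element n L.≈ e
    element-surjective e with surjective i e
    ... | a , p , eq with proj₁ (proj₂ enumerator) p
    ...   | n , refl = n , L.trans (index-irrelevant i _ p) eq

  module FiniteExtensionOfℚ (ext : Extension ℚ-field L) {deg : ℕ}
                            (hasDegree : HasDegree ℚ-field L ext deg) where

    open Extension ext using (embed; isRingMonomorphism; linearCombination)
    open HasDegree hasDegree
    open IsRingMonomorphism isRingMonomorphism
    private module ℚS = Sum ℚ.+-0-commutativeMonoid
    open SemiringSum L.semiring using
      (sum; sum-cong-≋; sum-replicate-zero; ∑-distrib-+; *-distribˡ-sum; *-distribʳ-sum)
    open GroupProperties L.+-group using () renaming (∙-cancelʳ to L-+-cancelʳ)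
    open CommutativeSemigroupProperties L.*-commutativeSemigroup
      using () renaming (interchange to *-interchange)
    open SetoidReasoning L.setoid

    combine : (Fin deg → ℚ) → L.Carrier
    combine a = linearCombination a basis

    combine-cong : ∀ {a b} → (∀ k → a k ≡ b k) → combine a L.≈ combine b
    combine-cong a≗b = sum-cong-≋ λ k → L.*-congʳ (⟦⟧-cong (a≗b k))

    combine-+ : ∀ a b → combine (λ k → a k ℚ.+ b k) L.≈ combine a L.+ combine b
    combine-+ a b = L.trans
      (sum-cong-≋ λ k → L.trans (L.*-congʳ (+-homo (a k) (b k))) (L.distribʳ _ _ _))
      (∑-distrib-+ (λ k → embed (a k) L.* basis k) _)

    combine-scale : ∀ r a → combine (λ k → r ℚ.* a k) L.≈ embed r L.* combine a
    combine-scale r a = L.trans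
      (sum-cong-≋ λ k → L.trans (L.*-congʳ (*-homo r (a k))) (L.*-assoc _ _ _))
      (L.sym (*-distribˡ-sum (embed r) (λ k → embed (a k) L.* basis k)))

    combine-sum : ∀ {n} (u : Fin n → Fin deg → ℚ) →
                  combine (λ k → ℚS.sum (λ t → u t k)) L.≈ sum (λ t → combine (u t))
    combine-sum {zero} u = begin
      combine (λ _ → ℚ.0ℚ)
        ≈⟨ sum-cong-≋ (λ k → L.trans (L.*-congʳ 0#-homo) (L.zeroˡ (basis k))) ⟩
      sum {deg} (λ _ → L.0#)
        ≈⟨ sum-replicate-zero deg ⟩
      L.0# ∎
    combine-sum {suc n} u = L.trans (combine-+ (u zero) _) (L.+-congˡ (combine-sum (u ∘ suc)))

    combine-injective : ∀ {a b} → combine a L.≈ combine b → ∀ k → a k ≡ b k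
    combine-injective {a} {b} eq k =
      +-cancelʳ (ℚ.- b k) (a k) (b k) (trans (independent a-b a-b≈0 k) (sym (ℚ.+-inverseʳ (b k))))
      where
      a-b : Fin deg → ℚ
      a-b k = a k ℚ.- b k

      a-b≈0 : combine a-b L.≈ L.0#
      a-b≈0 = L-+-cancelʳ (combine b) _ _ (begin
        combine a-b L.+ combine b       ≈⟨ combine-+ a-b b ⟨
        combine (λ k → a-b k ℚ.+ b k)   ≈⟨ combine-cong (λ k → x-y+y≡x (a k) (b k)) ⟩
        combine a                       ≈⟨ eq ⟩
        combine b                       ≈⟨ L.+-identityˡ _ ⟨
        L.0# L.+ combine b              ∎)
        where
        open +-*-Solver using (solve; _:-_; _:+_; _:=_)

        x-y+y≡x : ∀ x y → (x ℚ.- y) ℚ.+ y ≡ x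
        x-y+y≡x = solve 2 (λ x y → (x :- y) :+ y := x) refl

    structureConstant : Fin deg → Fin deg → Fin deg → ℚ
    structureConstant s t = proj₁ (spanning (basis s L.* basis t))

    multiply : (Fin deg → ℚ) → (Fin deg → ℚ) → Fin deg → ℚ
    multiply a b k = ℚS.sum λ s → ℚS.sum λ t → (a s ℚ.* b t) ℚ.* structureConstant s t k

    combine-* : ∀ a b → combine (multiply a b) L.≈ combine a L.* combine b
    combine-* a b = begin
      combine (multiply a b)
        ≈⟨ combine-sum (λ s k → ℚS.sum λ t → (a s ℚ.* b t) ℚ.* structureConstant s t k) ⟩
      sum (λ s → combine λ k → ℚS.sum λ t → (a s ℚ.* b t) ℚ.* structureConstant s t k)
        ≈⟨ sum-cong-≋ (λ s → combine-sum λ t k → (a s ℚ.* b t) ℚ.* structureConstant s t k) ⟩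
      sum (λ s → sum λ t → combine λ k → (a s ℚ.* b t) ℚ.* structureConstant s t k)
        ≈⟨ sum-cong-≋ (λ s → sum-cong-≋ (term s)) ⟩
      sum (λ s → sum λ t → (embed (a s) L.* basis s) L.* (embed (b t) L.* basis t))
        ≈⟨ sum-cong-≋ (λ s → *-distribˡ-sum (embed (a s) L.* basis s)
                                            (λ t → embed (b t) L.* basis t)) ⟨
      sum (λ s → (embed (a s) L.* basis s) L.* combine b)
        ≈⟨ *-distribʳ-sum (combine b) (λ s → embed (a s) L.* basis s) ⟨
      combine a L.* combine b ∎
      where
      term : ∀ s t → combine (λ k → (a s ℚ.* b t) ℚ.* structureConstant s t k) L.≈
                     (embed (a s) L.* basis s) L.* (embed (b t) L.* basis t)
      term s t = begin
        combine (λ k → (a s ℚ.* b t) ℚ.* structureConstant s t k)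
          ≈⟨ combine-scale (a s ℚ.* b t) (structureConstant s t) ⟩
        embed (a s ℚ.* b t) L.* combine (structureConstant s t)
          ≈⟨ L.*-cong (*-homo (a s) (b t)) (L.sym (proj₂ (spanning (basis s L.* basis t)))) ⟩
        (embed (a s) L.* embed (b t)) L.* (basis s L.* basis t)
          ≈⟨ *-interchange (embed (a s)) (embed (b t)) (basis s) (basis t) ⟩
        (embed (a s) L.* basis s) L.* (embed (b t) L.* basis t) ∎

    infix 4 _≟_
    _≟_ : ∀ d e → Dec (d L.≈ e)
    d ≟ e with spanning d | spanning e
    ... | a , d≈a | b , e≈b = map′
      (λ a≗b → L.trans d≈a (L.trans (combine-cong a≗b) (L.sym e≈b)))
      (λ d≈e → combine-injective (L.trans (L.sym d≈a) (L.trans d≈e e≈b)))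
      (all? λ k → a k ℚ.≟ b k)

    -- The standard indexing

    coordinate : ℕ → Fin deg → ℚ
    coordinate n k = rational (component k n)

    decode : ℕ → L.Carrier
    decode n = combine (coordinate n)

    decode-encode : ∀ {a v} → (∀ k → rational (v k) ≡ a k) → decode (encode v) L.≈ combine a
    decode-encode {v = v} eqs =
      combine-cong λ k → trans (≡.cong rational (component-encode v k)) (eqs k)

    decode-surjective : ∀ e → ∃[ n ] decode n L.≈ e
    decode-surjective e with a , e≈a ← spanning e =
      encode (λ k → proj₁ (rational-surjective (a k))) ,
      L.trans (decode-encode (λ k → proj₂ (rational-surjective (a k)))) (L.sym e≈a)

    encode∈ : ∀ {fs : Fin deg → Rec m} {a} → (∀ k → fs k [ xs ]∈ λ n → rational n ≡ a k) →
              encodeᶠ fs [ xs ]∈ λ n → decode n L.≈ combine a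
    encode∈ ps = _ , encode⇓ (λ k → proj₁ (proj₂ (ps k))) ,
      decode-encode (λ k → proj₂ (proj₂ (ps k)))

    coordinate∈ : ∀ k {f : Rec m} → f [ xs ]⇓ n →
                  componentᶠ k f [ xs ]∈ λ c → rational c ≡ coordinate n k
    coordinate∈ k p = _ , component⇓ k p , refl

    private module ℚR = Realizability rationalRealizability

    decode-+ᶠ decode-*ᶠ decode-≈ᶠ : Rec 2
    decode-+ᶠ = encodeᶠ λ k → ℚR.+ᶠ (componentᶠ {deg} k (proj 0F)) (componentᶠ k (proj 1F))
    decode-*ᶠ = encodeᶠ λ k → ℚR.∑ᶠ λ s → ℚR.∑ᶠ λ t →
      ℚR.*ᶠ (ℚR.*ᶠ (componentᶠ {deg} s (proj 0F)) (componentᶠ {deg} t (proj 1F)))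
            (ℚR.constant (structureConstant s t k))
    decode-≈ᶠ = ⋀ᶠ λ k → rational-≡ᶠ (componentᶠ {deg} k (proj 0F)) (componentᶠ k (proj 1F))

    decode-+∈ : ∀ x y → decode-+ᶠ [ x ∷ y ∷ [] ]∈ λ z → decode z L.≈ decode x L.+ decode y
    decode-+∈ x y =
      ∈-map (λ eq → L.trans eq (combine-+ (coordinate x) (coordinate y)))
        (encode∈ {a = λ k → coordinate x k ℚ.+ coordinate y k} λ k →
          ℚR.+∈ (coordinate∈ k (proj⇓ 0F)) (coordinate∈ k (proj⇓ 1F)))

    decode-*∈ : ∀ x y → decode-*ᶠ [ x ∷ y ∷ [] ]∈ λ z → decode z L.≈ decode x L.* decode y
    decode-*∈ x y =
      ∈-map (λ eq → L.trans eq (combine-* (coordinate x) (coordinate y)))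
        (encode∈ {a = multiply (coordinate x) (coordinate y)} λ k → ℚR.∑∈ λ s → ℚR.∑∈ λ t →
          ℚR.*∈ (ℚR.*∈ (coordinate∈ s (proj⇓ 0F)) (coordinate∈ t (proj⇓ 1F)))
                (ℚR.constant∈ (structureConstant s t k)))

    decode-≈-decides : ∀ x y → Decides decode-≈ᶠ (x ∷ y ∷ []) (decode x L.≈ decode y)
    decode-≈-decides x y =
      ∈-map (λ iff → mk⇔ (combine-cong ∘ to iff) (from iff ∘ combine-injective))
        (⋀-decides λ k → rational-≡-decides
          (component⇓ {k = deg} k (proj⇓ 0F)) (component⇓ {k = deg} k (proj⇓ 1F)))

    standardIndexing : Indexing (domain (fieldStructure L))
    standardIndexing = record
      { dom              = U
      ; index            = λ {n} _ → decode n
      ; index-irrelevant = λ _ _ → L.refl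
      ; dom-enumerable   = inj₂ (identity , (λ _ → _ , refl) , _)
      ; surjective       = λ e → let n , eq = decode-surjective e in n , _ , eq
      ; eq               = record { program = const 1 ⊖ decode-≈ᶠ ; defined = eq-defined }
      ; eq-1             = λ {x} {y} _ _ x≈y →
          ≡.cong (1 ∸_) (from (proj₂ (proj₂ (decode-≈-decides x y))) x≈y)
      ; eq-0             = λ {x} {y} _ _ x≉y →
          1∸n≡0 (λ v≡0 → x≉y (to (proj₂ (proj₂ (decode-≈-decides x y))) v≡0))
      }
      where
      identity : ComputableFunction {1} U U
      identity = record { program = proj 0F ; defined = λ { {_ ∷ []} _ → _ , proj⇓ 0F , _ } }

      1∸n-bit : ∀ n → 1 ∸ n ≡ 0 ⊎ 1 ∸ n ≡ 1
      1∸n-bit zero    = inj₂ refl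
      1∸n-bit (suc n) = inj₁ (ℕ.0∸n≡0 n)

      1∸n≡0 : ¬ n ≡ 0 → 1 ∸ n ≡ 0
      1∸n≡0 {zero}  n≢0 = contradiction refl n≢0
      1∸n≡0 {suc n} n≢0 = ℕ.0∸n≡0 n

      eq-defined : ∀ {xs} → All U xs → (const 1 ⊖ decode-≈ᶠ) [ xs ]∈ λ b → b ≡ 0 ⊎ b ≡ 1
      eq-defined {x ∷ y ∷ []} _ =
        let v , ⇓v , _ = decode-≈-decides x y in 1 ∸ v , ⊖⇓ (const⇓ 1) ⇓v , 1∸n-bit v

    standardIndexing-admissible : Admissible (fieldStructure L) standardIndexing
    standardIndexing-admissible =
      (+^ , λ { (_∷_ {x = x} _ (_∷_ {x = y} _ [])) → proj₂ (proj₂ (decode-+∈ x y)) }) ListAll.∷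
      (*^ , λ { (_∷_ {x = x} _ (_∷_ {x = y} _ [])) → proj₂ (proj₂ (decode-*∈ x y)) }) ListAll.∷
      ListAll.[]
      where
      +^ *^ : ComputableFunction {2} (All U) U
      +^ = record
        { program = decode-+ᶠ
        ; defined = λ { {x ∷ y ∷ []} (_ ∷ _ ∷ []) → ∈-map _ (decode-+∈ x y) }
        }
      *^ = record
        { program = decode-*ᶠ
        ; defined = λ { {x ∷ y ∷ []} (_ ∷ _ ∷ []) → ∈-map _ (decode-*∈ x y) }
        }

    -- Translation of the standard indexing into an arbitrary admissible one

    module FromStandard (j : Indexing (domain (fieldStructure L)))
                        (admissible : Admissible (fieldStructure L) j) where

      open AdmissibleIndexing j admissible public

      naturalᶠ : Rec 1
      naturalᶠ = prec (constant L.0#) (+ᶠ (constant L.1#) (proj 1F))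

      natural∈ : ∀ n → naturalᶠ [ n ∷ [] ]∈ (_⊩ embed ⟪ n ⟫)
      natural∈ zero with a , ⇓a , a⊩ ← constant∈ L.0# =
        a , prec⇓-zero ⇓a , ⊩-resp (L.sym (L.trans (⟦⟧-cong ⟪0⟫) 0#-homo)) a⊩
      natural∈ (suc n)
        with y , ⇓y , y⊩ ← natural∈ n
        with z , ⇓z , z⊩ ← +∈ (constant∈ L.1#) (y , proj⇓ {xs = n ∷ y ∷ []} 1F , y⊩) =
        z , prec⇓-suc ⇓y ⇓z , ⊩-resp (L.sym ⟪suc⟫) z⊩
        where
        ⟪suc⟫ : embed ⟪ suc n ⟫ L.≈ L.1# L.+ embed ⟪ n ⟫
        ⟪suc⟫ = begin
          embed ⟪ suc n ⟫                  ≈⟨ ⟦⟧-cong (⟪⟫-homo-+ 1 n) ⟩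
          embed (⟪ 1 ⟫ ℚ.+ ⟪ n ⟫)          ≈⟨ +-homo ⟪ 1 ⟫ ⟪ n ⟫ ⟩
          embed ⟪ 1 ⟫ L.+ embed ⟪ n ⟫      ≈⟨ L.+-congʳ (L.trans (⟦⟧-cong ⟪1⟫) 1#-homo) ⟩
          L.1# L.+ embed ⟪ n ⟫             ∎

      comp-natural∈ : ∀ {f : Rec m} → f [ xs ]⇓ n → comp₁ naturalᶠ f [ xs ]∈ (_⊩ embed ⟪ n ⟫)
      comp-natural∈ p with a , ⇓a , a⊩ ← natural∈ _ = a , comp₁⇓ p ⇓a , a⊩

      IsQuotient : ℕ → L.Carrier → Set _
      IsQuotient c e =
        embed ⟪ suc (den c) ⟫ L.* e L.+ embed ⟪ num⁻ c ⟫ L.≈ embed ⟪ num⁺ c ⟫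

      rational-isQuotient : ∀ c → IsQuotient c (embed (rational c))
      rational-isQuotient c = begin
        embed ⟪ suc (den c) ⟫ L.* embed (rational c) L.+ embed ⟪ num⁻ c ⟫
          ≈⟨ L.+-congʳ (*-homo ⟪ suc (den c) ⟫ (rational c)) ⟨
        embed (⟪ suc (den c) ⟫ ℚ.* rational c) L.+ embed ⟪ num⁻ c ⟫
          ≈⟨ +-homo (⟪ suc (den c) ⟫ ℚ.* rational c) ⟪ num⁻ c ⟫ ⟨
        embed (⟪ suc (den c) ⟫ ℚ.* rational c ℚ.+ ⟪ num⁻ c ⟫)
          ≈⟨ ⟦⟧-cong (rational-isFraction c) ⟩
        embed ⟪ num⁺ c ⟫ ∎

      IsQuotient-unique : ∀ c {d e} → IsQuotient c d → IsQuotient c e → d L.≈ e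
      IsQuotient-unique c {d} {e} isD isE = begin
        d
          ≈⟨ undo d ⟨
        embed (reciprocal (den c)) L.* (embed ⟪ suc (den c) ⟫ L.* d)
          ≈⟨ L.*-congˡ (L-+-cancelʳ _ _ _ (L.trans isD (L.sym isE))) ⟩
        embed (reciprocal (den c)) L.* (embed ⟪ suc (den c) ⟫ L.* e)
          ≈⟨ undo e ⟩
        e ∎
        where
        undo : ∀ e → embed (reciprocal (den c)) L.* (embed ⟪ suc (den c) ⟫ L.* e) L.≈ e
        undo e = begin
          embed (reciprocal (den c)) L.* (embed ⟪ suc (den c) ⟫ L.* e)
            ≈⟨ L.*-assoc _ _ _ ⟨
          embed (reciprocal (den c)) L.* embed ⟪ suc (den c) ⟫ L.* e
            ≈⟨ L.*-congʳ (*-homo (reciprocal (den c)) ⟪ suc (den c) ⟫) ⟨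
          embed (reciprocal (den c) ℚ.* ⟪ suc (den c) ⟫) L.* e
            ≈⟨ L.*-congʳ (L.trans (⟦⟧-cong (reciprocal-inverse (den c))) 1#-homo) ⟩
          L.1# L.* e
            ≈⟨ L.*-identityˡ e ⟩
          e ∎

      quotientTest : Rec 2
      quotientTest = equalᶠ
        (+ᶠ (*ᶠ (comp₁ naturalᶠ (denomᶠ (proj 1F))) (elementᶠ (proj 0F)))
            (comp₁ naturalᶠ (num⁻ᶠ (proj 1F))))
        (comp₁ naturalᶠ (num⁺ᶠ (proj 1F)))

      quotientTest-decides : ∀ c n → Decides quotientTest (n ∷ c ∷ []) (IsQuotient c (element n))
      quotientTest-decides c n = equal-decides (_ ≟ _)
        (+∈ (*∈ (comp-natural∈ (denom⇓ p)) (element∈ (proj⇓ 0F))) (comp-natural∈ (num⁻⇓ p)))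
        (comp-natural∈ (num⁺⇓ p))
        where
        p : proj 1F [ n ∷ c ∷ [] ]⇓ c
        p = proj⇓ 1F

      rationalᶠ : Rec 1
      rationalᶠ = elementᶠ (μ quotientTest)

      rational∈ : ∀ c → rationalᶠ [ c ∷ [] ]∈ (_⊩ embed (rational c))
      rational∈ c =
        let n , ≈r       = element-surjective (embed (rational c))
            _ , ⇓k , isQ = search (quotientTest-decides c)
              (n , L.trans (L.+-congʳ (L.*-congˡ ≈r)) (rational-isQuotient c))
        in ∈-resp (IsQuotient-unique c isQ (rational-isQuotient c)) (element∈ ⇓k)

      decodeᶠ : Rec m → Rec m
      decodeᶠ f = ∑ᶠ λ k → *ᶠ (comp₁ rationalᶠ (componentᶠ {deg} k f)) (constant (basis k))

      decode∈ : ∀ {f : Rec m} → f [ xs ]⇓ n → decodeᶠ f [ xs ]∈ (_⊩ decode n)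
      decode∈ p = ∑∈ λ k →
        let a , ⇓a , a⊩ = rational∈ (component k _)
        in *∈ (a , comp₁⇓ (component⇓ k p) ⇓a , a⊩) (constant∈ (basis k))

    admissible⇒reduces : ∀ j j′ → Admissible (fieldStructure L) j →
                         Admissible (fieldStructure L) j′ → Reduces j′ j
    admissible⇒reduces j j′ adm adm′ =
      record { program = J.decodeᶠ (μ test)
             ; defined = λ { (p ∷ []) → let a , ⇓a , q , _ = translate p in a , ⇓a , q } } ,
      λ p → L.sym (proj₂ (proj₂ (proj₂ (translate p))))
      where
      module J  = FromStandard j adm
      module J′ = FromStandard j′ adm′

      test : Rec 2
      test = J′.equalᶠ (J′.decodeᶠ (proj 0F)) (proj 1F)

      translate : ∀ {x} (p : dom j′ x) → J.decodeᶠ (μ test) [ x ∷ [] ]∈ (J._⊩ index j′ p)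
      translate p =
        let e = index j′ p
            _ , ⇓n , n≈e = search
              (λ n → J′.equal-decides (decode n ≟ e)
                (J′.decode∈ (proj⇓ 0F)) (_ , proj⇓ 1F , p , L.refl))
              (decode-surjective e)
        in J.∈-resp n≈e (J.decode∈ ⇓n)

proposition11 : ∀ {c ℓ₁ ℓ₂} (L : HeytingField c ℓ₁ ℓ₂) →
    FiniteExtension ℚ-field L → ComputabilityStable (fieldStructure L)
proposition11 L (ext , deg , hasDegree) =
  (standardIndexing , standardIndexing-admissible) , admissible⇒reduces
  where open FiniteExtensionOfℚ L ext hasDegree
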